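{- Let $\Delta\ge1$ be an integer and let $G=(V,E)$ be an $n$-vertex, unweighted, possibly directed graph whose edges are colored so that every color class has at most $\Delta$ edges. For every set of pairs $P\subseteq V\times V$ there is a $1$-CFT $P$-distance preserver $H\subseteq G$ with \[ |E(H)| = O\Big(n^{2-\frac{2}{2\Delta+3}} \cdot |P|^{\frac{1}{2\Delta+3}} \cdot \Delta \log n\Big). \]
   Context: An edge-colored graph assigns each edge exactly one color, with no restrictions; a color class is the set of edges of one color. For a color $c$, $G-c$ denotes $G$ with all edges of color $c$ deleted. A subgraph $H\subseteq G$ is a $1$-CFT $P$-distance preserver if for every color $c$ and every $(s,t)\in P$, the distance from $s$ to $t$ in $H-c$ equals the distance from $s$ to $t$ in $G-c$. -}

module Defs where

open import Data.Nat using (ℕ; zero; suc; _≤_; _≟_)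
open import Data.Fin using (Fin)
open import Data.Bool using (Bool; true; false)
open import Data.List using (List; []; _∷_)
open import Data.List.Relation.Unary.All using (All)
open import Data.List.Relation.Unary.AllPairs using (AllPairs)
open import Data.List.Membership.Propositional using (_∈_)
open import Data.Product using (_×_; _,_; ∃; ∃-syntax; proj₁; proj₂)
open import Data.Sum using (_⊎_)
open import Relation.Nullary using (¬_; yes; no)
open import Relation.Binary.PropositionalEquality using (_≡_; _≢_)
open import Function.Bundles using (_⇔_)

Edge : ℕ → Set
Edge n = Fin n × Fin n × ℕ

src : ∀ {n} → Edge n → Fin n
src (u , v , c) = u

tgt : ∀ {n} → Edge n → Fin n
tgt (u , v , c) = v

color : ∀ {n} → Edge n → ℕ
color (u , v , c) = c

-- 'directed = true': edges are arcs u → v; 'false': edges are undirected.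
-- Two edges join the same (ordered / unordered) pair of vertices.
SameLink : ∀ {n} → Bool → Edge n → Edge n → Set
SameLink true  e f = (src e ≡ src f) × (tgt e ≡ tgt f)
SameLink false e f = ((src e ≡ src f) × (tgt e ≡ tgt f))
                   ⊎ ((src e ≡ tgt f) × (tgt e ≡ src f))

Simple : ∀ {n} → Bool → List (Edge n) → Set
Simple d E = All (λ e → src e ≢ tgt e) E × AllPairs (λ e f → ¬ SameLink d e f) E

colorClass : ∀ {n} → ℕ → List (Edge n) → List (Edge n)
colorClass c [] = []
colorClass c (e ∷ E) with color e ≟ c
... | yes _ = e ∷ colorClass c E
... | no  _ = colorClass c E

deleteColor : ∀ {n} → ℕ → List (Edge n) → List (Edge n)
deleteColor c [] = []
deleteColor c (e ∷ E) with color e ≟ c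
... | yes _ = deleteColor c E
... | no  _ = e ∷ deleteColor c E

Step : ∀ {n} → Bool → List (Edge n) → Fin n → Fin n → Set
Step true  E u w = ∃[ c ] ((u , w , c) ∈ E)
Step false E u w = ∃[ c ] (((u , w , c) ∈ E) ⊎ ((w , u , c) ∈ E))

data Walk {n} (d : Bool) (E : List (Edge n)) : Fin n → Fin n → ℕ → Set where
  here  : ∀ {s} → Walk d E s s zero
  there : ∀ {u w t k} → Step d E u w → Walk d E w t k → Walk d E u t (suc k)

DistAtMost : ∀ {n} → Bool → List (Edge n) → Fin n → Fin n → ℕ → Set
DistAtMost d E s t k = ∃[ j ] ((j ≤ k) × Walk d E s t j)

-- dist_E(s,t) = dist_F(s,t) (as values in ℕ ∪ {∞}):
-- both distances have the same set of upper bounds.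
SameDist : ∀ {n} → Bool → List (Edge n) → List (Edge n) → Fin n → Fin n → Set
SameDist d E F s t = ∀ k → DistAtMost d E s t k ⇔ DistAtMost d F s t k

-- H is a 1-CFT P-distance preserver of G (H ⊆ G is required separately).
OneCFTPreserver : ∀ {n} → Bool → List (Edge n) → List (Edge n)
                → List (Fin n × Fin n) → Set
OneCFTPreserver d G H P =
  ∀ (c : ℕ) {s t} → (s , t) ∈ P →
    SameDist d (deleteColor c G) (deleteColor c H) s t

{-# OPTIONS --safe #-}
module Submission where

-- A color c removes at most Δ edges, so scales ρ, ρ², …, ρ^(Δ+1) suffice. A pair at distance below ρ^(Δ+1)
-- buys its shortest path together with the replacement paths for the colors on it; every longer replacement
-- path meets a hitting set R of about (n log n)/ρ^(Δ+1) vertices, and it remains to preserve V × R and R × V.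
-- For a source v keep, for every r in R, the first edge of a shortest v–r path and of its replacement paths
-- for the colors of the first ρ^Δ edges. A replacement path for another color c of that path meets a hitting
-- set for scale ρ^Δ within its first ρ^Δ edges, and the shortest paths from v to the vertices met there are
-- too short to reach the edge of color c just found. Hence each change of scale uses up an edge of color c,
-- and after Δ changes no edge is left. All this costs O(Δ log n · n²/ρ) edges; take ρ maximal with
-- |P| ρ^(2Δ+3) ≤ n².

open import Defs
import Algebra.Properties.CommutativeSemigroup as CommutativeSemigroup
open import Data.Nat using (ℕ; zero; suc; _≤_; _<_; _*_; _+_; _^_; _∸_; ⌈_/2⌉; z≤n; s≤s; >-nonZero)
open import Data.Nat.ListAction using (sum)
open import Data.Nat.Logarithm using (⌈log₂_⌉; ⌈log₂⌉-mono-≤; ⌈log₂⌈n/2⌉⌉≡⌈log₂n⌉∸1)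
open import Data.Nat.Properties
open import Data.Nat.Induction using (<-rec)
open import Data.Nat.Tactic.RingSolver using (solve-∀)
open import Data.Bool using (Bool; true; false)
open import Data.Fin using (Fin)
import Data.Fin.Properties as Fin
open import Data.List using (List; []; _∷_; [_]; _++_; length; map; take; filter; allFin; concatMap; cartesianProduct)
open import Data.List.Properties using (length-++; length-map; length-take; length-tabulate; take-all)
open import Data.List.Membership.Propositional using (_∈_; find; lose)
open import Data.List.Membership.Propositional.Properties using (∈-∃++; ∈-++⁺ˡ; ∈-++⁺ʳ; ∈-++⁻; ∈-map⁺; ∈-map⁻; ∈-filter⁺; ∈-filter⁻; ∈-allFin; ∈-cartesianProduct⁺; ∈-concatMap⁺; ∈-concatMap⁻)
import Data.List.Membership.DecPropositional as DecMembership
open import Data.List.Relation.Unary.All as All using (All; []; _∷_)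
open import Data.List.Relation.Unary.AllPairs using ([]; _∷_)
open import Data.List.Relation.Unary.Any using (Any; here; there; any?)
open import Data.List.Relation.Unary.Unique.Propositional using (Unique)
import Data.List.Relation.Unary.Unique.Propositional.Properties as Unique
open import Data.List.Relation.Binary.Sublist.Propositional using (_⊆_; minimum)
open import Data.List.Relation.Binary.Sublist.Propositional.Properties using (filter-⊆)
open import Data.Product using (_×_; _,_; ∃; ∃-syntax; proj₁; proj₂)
open import Data.Product.Properties using (≡-dec)
open import Data.Sum using (_⊎_; inj₁; inj₂)
open import Function using (_∘_)
open import Function.Bundles using (_⇔_; mk⇔)
open import Relation.Nullary using (Dec; yes; no; contradiction)
open import Relation.Nullary.Decidable using (map′; _×-dec_; _⊎-dec_)
open import Relation.Binary.PropositionalEquality using (_≡_; _≢_; refl; sym; trans; cong; cong₂; subst)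

-- Pigeonhole principles

unique⇒length≤ : {A : Set} {xs ys : List A} → Unique xs → (∀ {x} → x ∈ xs → x ∈ ys) → length xs ≤ length ys
unique⇒length≤ [] _ = z≤n
unique⇒length≤ {xs = x ∷ xs} (x∉xs ∷ u) sub with ∈-∃++ (sub (here refl))
... | ys , zs , refl = begin
  suc (length xs)              ≤⟨ s≤s (unique⇒length≤ u sub′) ⟩
  suc (length (ys ++ zs))      ≡⟨ cong suc (length-++ ys) ⟩
  suc (length ys + length zs)  ≡⟨ sym (+-suc _ _) ⟩
  length ys + suc (length zs)  ≡⟨ sym (length-++ ys) ⟩
  length (ys ++ x ∷ zs)        ∎
  where
  open ≤-Reasoning
  sub′ : ∀ {y} → y ∈ xs → y ∈ ys ++ zs
  sub′ y∈xs with ∈-++⁻ ys (sub (there y∈xs))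
  ... | inj₁ y∈ys         = ∈-++⁺ˡ y∈ys
  ... | inj₂ (here y≡x)   = contradiction (sym y≡x) (All.lookup x∉xs y∈xs)
  ... | inj₂ (there y∈zs) = ∈-++⁺ʳ ys y∈zs

length-allFin : ∀ n → length (allFin n) ≡ n
length-allFin n = length-tabulate {n = n} (λ i → i)

length-cartesianProduct : {A B : Set} (xs : List A) (ys : List B) → length (cartesianProduct xs ys) ≡ length xs * length ys
length-cartesianProduct []       ys = refl
length-cartesianProduct (x ∷ xs) ys = trans (length-++ (map (x ,_) ys))
  (cong₂ _+_ (length-map (x ,_) ys) (length-cartesianProduct xs ys))

unique-pairs⇒length≤ : ∀ {n} {xs : List (Fin n × Fin n)} → Unique xs → length xs ≤ n * n
unique-pairs⇒length≤ {n} {xs} u = begin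
  length xs                                        ≤⟨ unique⇒length≤ u (λ _ → ∈-cartesianProduct⁺ (∈-allFin _) (∈-allFin _)) ⟩
  length (cartesianProduct (allFin n) (allFin n))  ≡⟨ length-cartesianProduct (allFin n) (allFin n) ⟩
  length (allFin n) * length (allFin n)            ≡⟨ cong₂ _*_ (length-allFin n) (length-allFin n) ⟩
  n * n                                            ∎
  where open ≤-Reasoning

length-concatMap*≤ : {A B : Set} (f : A → List B) (w : ℕ) {q : ℕ} → (∀ x → length (f x) * w ≤ q) → ∀ xs → length (concatMap f xs) * w ≤ length xs * q
length-concatMap*≤ f w bound []       = z≤n
length-concatMap*≤ f w {q} bound (x ∷ xs) = begin
  length (f x ++ concatMap f xs) * w             ≡⟨ cong (_* w) (length-++ (f x)) ⟩
  (length (f x) + length (concatMap f xs)) * w   ≡⟨ *-distribʳ-+ w (length (f x)) _ ⟩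
  length (f x) * w + length (concatMap f xs) * w ≤⟨ +-mono-≤ (bound x) (length-concatMap*≤ f w bound xs) ⟩
  q + length xs * q                              ∎
  where open ≤-Reasoning

length-concatMap≤ : {A B : Set} (f : A → List B) {q : ℕ} → (∀ x → length (f x) ≤ q) → ∀ xs → length (concatMap f xs) ≤ length xs * q
length-concatMap≤ f bound xs = subst (_≤ _) (*-identityʳ _)
  (length-concatMap*≤ f 1 (λ x → subst (_≤ _) (sym (*-identityʳ _)) (bound x)) xs)

-- A positive sum rules out the empty list, which has no entry to serve as witness.
sum≤length*max : {A : Set} (f : A → ℕ) (xs : List A) → 0 < sum (map f xs) → ∃[ x ] (sum (map f xs) ≤ length xs * f x)
sum≤length*max f (x ∷ xs) _ with 0 <? sum (map f xs)
... | no ≯0 = x , +-monoʳ-≤ (f x) (≤-trans (≮⇒≥ ≯0) z≤n)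
... | yes >0 with sum≤length*max f xs >0
... | z , sum≤ with ≤-total (f x) (f z)
... | inj₁ fx≤fz = z , +-mono-≤ fx≤fz sum≤
... | inj₂ fz≤fx = x , +-monoʳ-≤ (f x) (≤-trans sum≤ (*-monoʳ-≤ (length xs) fz≤fx))

-- Greedy hitting sets

module HittingSet (n L : ℕ) (1≤L : 1 ≤ L) where

  open DecMembership (Fin._≟_ {n}) using (_∈?_; _∉?_)

  Large : List (Fin n) → Set
  Large S = Unique S × L ≤ length S

  Hit : List (Fin n) → List (Fin n) → Set
  Hit R S = ∃[ r ] (r ∈ R × r ∈ S)

  hits misses : Fin n → List (List (Fin n)) → List (List (Fin n))
  hits   u = filter (u ∈?_)
  misses u = filter (u ∉?_)

  length-hits+misses : ∀ u 𝓢 → length (hits u 𝓢) + length (misses u 𝓢) ≡ length 𝓢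
  length-hits+misses u [] = refl
  length-hits+misses u (S ∷ 𝓢) with u ∈? S
  ... | yes _ = cong suc (length-hits+misses u 𝓢)
  ... | no  _ = trans (+-suc _ _) (cong suc (length-hits+misses u 𝓢))

  ∈-hits⊎misses : ∀ {S} u 𝓢 → S ∈ 𝓢 → u ∈ S ⊎ S ∈ misses u 𝓢
  ∈-hits⊎misses {S} u 𝓢 S∈𝓢 with u ∈? S
  ... | yes u∈S = inj₁ u∈S
  ... | no  u∉S = inj₂ (∈-filter⁺ (u ∉?_) S∈𝓢 u∉S)

  sum-hits-∷ : ∀ S 𝓢 us → sum (map (λ u → length (hits u (S ∷ 𝓢))) us) ≡
    length (filter (_∈? S) us) + sum (map (λ u → length (hits u 𝓢)) us)
  sum-hits-∷ S 𝓢 [] = refl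
  sum-hits-∷ S 𝓢 (u ∷ us) with u ∈? S | trans (cong (length (hits u 𝓢) +_) (sum-hits-∷ S 𝓢 us))
                                          (CommutativeSemigroup.x∙yz≈y∙xz +-commutativeSemigroup (length (hits u 𝓢)) (length (filter (_∈? S) us)) _)
  ... | yes _ | eq = cong suc eq
  ... | no  _ | eq = eq

  -- Pairs of a vertex and a set containing it are counted twice: each set accounts for at least `L`
  -- of them, and vertex `u` for `length (hits u 𝓢)`.
  double-counting : ∀ 𝓢 → All Large 𝓢 → length 𝓢 * L ≤ sum (map (λ u → length (hits u 𝓢)) (allFin n))
  double-counting [] [] = z≤n
  double-counting (S ∷ 𝓢) ((uniq , L≤S) ∷ large) = begin
    L + length 𝓢 * L ≤⟨ +-mono-≤ L≤hit (double-counting 𝓢 large) ⟩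
    length (filter (_∈? S) (allFin n)) + sum (map (λ u → length (hits u 𝓢)) (allFin n)) ≡⟨ sum-hits-∷ S 𝓢 (allFin n) ⟨
    sum (map (λ u → length (hits u (S ∷ 𝓢))) (allFin n)) ∎
    where
    open ≤-Reasoning
    L≤hit : L ≤ length (filter (_∈? S) (allFin n))
    L≤hit = ≤-trans L≤S (unique⇒length≤ uniq (λ x∈S → ∈-filter⁺ (_∈? S) (∈-allFin _) x∈S))

  popular : ∀ 𝓢 → All Large 𝓢 → 1 ≤ length 𝓢 → ∃[ u ] (length 𝓢 * L ≤ n * length (hits u 𝓢))
  popular 𝓢 large 𝓢≢[] with sum≤length*max (λ u → length (hits u 𝓢)) (allFin n)
    (≤-trans (*-mono-≤ 𝓢≢[] 1≤L) (double-counting 𝓢 large))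
  ... | u , sum≤ = u , (begin
    length 𝓢 * L ≤⟨ double-counting 𝓢 large ⟩
    sum (map (λ u → length (hits u 𝓢)) (allFin n)) ≤⟨ sum≤ ⟩
    length (allFin n) * length (hits u 𝓢) ≡⟨ cong (_* length (hits u 𝓢)) (length-allFin n) ⟩
    n * length (hits u 𝓢) ∎)
    where open ≤-Reasoning

  -- `N` is the size of the family at the start of a round, `𝓣` what is left unhit at its end. The
  -- cost inequality is a potential argument: every set hit releases 2n, every vertex of `R`
  -- consumes `N * L`.
  Partial : ℕ → List (List (Fin n)) → Set
  Partial N 𝓢 = ∃[ R ] ∃[ 𝓣 ] (All Large 𝓣 × 2 * length 𝓣 ≤ N ×
    length R * (N * L) + 2 * n * length 𝓣 ≤ 2 * n * length 𝓢 × (∀ {S} → S ∈ 𝓢 → Hit R S ⊎ S ∈ 𝓣))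

  -- While more than N/2 sets remain, a most popular vertex hits at least NL/2n of them.
  greedy : ∀ N m 𝓢 → length 𝓢 ≡ m → All Large 𝓢 → Partial N 𝓢
  greedy N = <-rec _ go
    where
    go : ∀ m → (∀ {k} → k < m → ∀ 𝓢 → length 𝓢 ≡ k → All Large 𝓢 → Partial N 𝓢) →
      ∀ 𝓢 → length 𝓢 ≡ m → All Large 𝓢 → Partial N 𝓢
    go m rec 𝓢 refl large with 2 * length 𝓢 ≤? N
    ... | yes small = [] , 𝓢 , large , small , ≤-refl , inj₂
    ... | no ¬small with popular 𝓢 large (0<⇒ (length 𝓢) (≰⇒> ¬small))
      where
      0<⇒ : ∀ k → N < 2 * k → 1 ≤ k
      0<⇒ (suc k) _ = s≤s z≤n
    ... | u , pop with rec {length (misses u 𝓢)} fewer (misses u 𝓢) refl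
                        (All.tabulate (All.lookup large ∘ proj₁ ∘ ∈-filter⁻ (u ∉?_)))
      where
      -- The popular vertex hits at least one set, so the family strictly shrinks and the recursion
      -- terminates.
      0<hits : ∀ h → length 𝓢 * L ≤ n * h → 0 < h
      0<hits zero bad = contradiction (≤-trans (*-mono-≤ 1≤𝓢 1≤L) (≤-trans bad (≤-reflexive (*-zeroʳ n)))) λ ()
        where
        1≤𝓢 : 1 ≤ length 𝓢
        1≤𝓢 with length 𝓢 | ≰⇒> ¬small
        ... | suc _ | _ = s≤s z≤n
      0<hits (suc h) _ = s≤s z≤n
      fewer : length (misses u 𝓢) < length 𝓢
      fewer = subst (length (misses u 𝓢) <_) (length-hits+misses u 𝓢)
                (m<n+m (length (misses u 𝓢)) (0<hits _ pop))
    ... | R , 𝓣 , largeT , half , cost , hit = u ∷ R , 𝓣 , largeT , half , cost′ , hit′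
      where
      h = length (hits u 𝓢)
      x = length (misses u 𝓢)
      NL≤ : N * L ≤ 2 * n * h
      NL≤ = begin
        N * L                ≤⟨ *-monoˡ-≤ L (<⇒≤ (≰⇒> ¬small)) ⟩
        2 * length 𝓢 * L     ≡⟨ *-assoc 2 (length 𝓢) L ⟩
        2 * (length 𝓢 * L)   ≤⟨ *-monoʳ-≤ 2 pop ⟩
        2 * (n * h)          ≡⟨ *-assoc 2 n h ⟨
        2 * n * h            ∎
        where open ≤-Reasoning
      cost′ : N * L + length R * (N * L) + 2 * n * length 𝓣 ≤ 2 * n * length 𝓢
      cost′ = begin
        N * L + length R * (N * L) + 2 * n * length 𝓣   ≡⟨ +-assoc (N * L) _ _ ⟩
        N * L + (length R * (N * L) + 2 * n * length 𝓣) ≤⟨ +-mono-≤ NL≤ cost ⟩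
        2 * n * h + 2 * n * x                           ≡⟨ *-distribˡ-+ (2 * n) h x ⟨
        2 * n * (h + x)                                 ≡⟨ cong (2 * n *_) (length-hits+misses u 𝓢) ⟩
        2 * n * length 𝓢                                ∎
        where open ≤-Reasoning
      hit′ : ∀ {S} → S ∈ 𝓢 → Hit (u ∷ R) S ⊎ S ∈ 𝓣
      hit′ S∈𝓢 with ∈-hits⊎misses u 𝓢 S∈𝓢
      ... | inj₁ u∈S = inj₁ (u , here refl , u∈S)
      ... | inj₂ S∈m with hit S∈m
      ... | inj₁ (r , r∈R , r∈S) = inj₁ (r , there r∈R , r∈S)
      ... | inj₂ S∈𝓣 = inj₂ S∈𝓣

  abstract

    -- A round of `greedy` with `N` the current size leaves at most half of the sets and costs at
    -- most 2n/L vertices. Fewer than 2^b sets are used up after b rounds.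
    hittingSet : ∀ b 𝓢 → All Large 𝓢 → length 𝓢 < 2 ^ b →
      ∃[ R ] (length R * L ≤ 2 * n * b × (∀ {S} → S ∈ 𝓢 → Hit R S))
    hittingSet b [] _ _ = [] , z≤n , λ ()
    hittingSet zero (_ ∷ _) _ (s≤s ())
    hittingSet (suc b) 𝓢@(_ ∷ 𝓢′) large <2^b with greedy (length 𝓢) _ 𝓢 refl large
    ... | R , 𝓣 , largeT , half , cost , hit with hittingSet b 𝓣 largeT (*-cancelˡ-< 2 _ _ (≤-<-trans half <2^b))
    ... | R′ , cost′ , hit′ = R ++ R′ , cost″ , hit″
      where
      open ≤-Reasoning
      N : ℕ
      N = length 𝓢
      R≤ : length R * L ≤ 2 * n
      R≤ = *-cancelʳ-≤ _ _ N (begin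
        length R * L * N                             ≡⟨ *-assoc (length R) L N ⟩
        length R * (L * N)                           ≡⟨ cong (length R *_) (*-comm L N) ⟩
        length R * (N * L)                           ≤⟨ m≤m+n _ _ ⟩
        length R * (N * L) + 2 * n * length 𝓣        ≤⟨ cost ⟩
        2 * n * N                                    ∎)
      cost″ : length (R ++ R′) * L ≤ 2 * n * suc b
      cost″ = begin
        length (R ++ R′) * L          ≡⟨ cong (_* L) (length-++ R) ⟩
        (length R + length R′) * L    ≡⟨ *-distribʳ-+ L (length R) (length R′) ⟩
        length R * L + length R′ * L  ≤⟨ +-mono-≤ R≤ cost′ ⟩
        2 * n + 2 * n * b             ≡⟨ *-suc (2 * n) b ⟨
        2 * n * suc b                 ∎
      hit″ : ∀ {S} → S ∈ 𝓢 → Hit (R ++ R′) S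
      hit″ S∈𝓢 with hit S∈𝓢
      ... | inj₁ (r , r∈R , r∈S) = r , ∈-++⁺ˡ r∈R , r∈S
      ... | inj₂ S∈𝓣 with hit′ S∈𝓣
      ... | r , r∈R , r∈S = r , ∈-++⁺ʳ R r∈R , r∈S

-- Distances and walks

∈-deleteColor⁺ : ∀ {n c} {e : Edge n} {G} → e ∈ G → color e ≢ c → e ∈ deleteColor c G
∈-deleteColor⁺ {c = c} {G = f ∷ G} e∈G e≢c with color f ≟ c | e∈G
... | yes f≡c | here refl = contradiction f≡c e≢c
... | yes _   | there e∈  = ∈-deleteColor⁺ e∈ e≢c
... | no  _   | here e≡f  = here e≡f
... | no  _   | there e∈  = there (∈-deleteColor⁺ e∈ e≢c)

∈-deleteColor⁻ : ∀ {n c} {e : Edge n} G → e ∈ deleteColor c G → e ∈ G × color e ≢ c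
∈-deleteColor⁻ {c = c} (f ∷ G) e∈ with color f ≟ c | e∈
... | yes _   | e∈        = let e∈G , e≢c = ∈-deleteColor⁻ G e∈ in there e∈G , e≢c
... | no  f≢c | here refl = here refl , f≢c
... | no  _   | there e∈  = let e∈G , e≢c = ∈-deleteColor⁻ G e∈ in there e∈G , e≢c

∈-colorClass⁺ : ∀ {n c} {e : Edge n} {G} → e ∈ G → color e ≡ c → e ∈ colorClass c G
∈-colorClass⁺ {c = c} {G = f ∷ G} e∈G e≡c with color f ≟ c | e∈G
... | yes _   | here e≡f  = here e≡f
... | yes _   | there e∈  = there (∈-colorClass⁺ e∈ e≡c)
... | no  f≢c | here refl = contradiction e≡c f≢c
... | no  _   | there e∈  = ∈-colorClass⁺ e∈ e≡c

-- Ranging over G and the graphs G − color e for e ∈ G avoids quantifying over all colors.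
deletions : ∀ {n} → List (Edge n) → List (List (Edge n))
deletions G = G ∷ map (λ e → deleteColor (color e) G) G

deleteColor-absent : ∀ {n} c (G : List (Edge n)) → (∀ {e} → e ∈ G → color e ≢ c) → deleteColor c G ≡ G
deleteColor-absent c []      _ = refl
deleteColor-absent c (e ∷ G) c∉G with color e ≟ c
... | yes e≡c = contradiction e≡c (c∉G (here refl))
... | no  _   = cong (e ∷_) (deleteColor-absent c G (c∉G ∘ there))

deleteColor∈deletions : ∀ {n} c (G : List (Edge n)) → deleteColor c G ∈ deletions G
deleteColor∈deletions c G with any? (λ e → color e ≟ c) G
... | yes c∈G with e , e∈G , refl ← find c∈G = there (∈-map⁺ (λ e → deleteColor (color e) G) e∈G)
... | no  c∉G = here (deleteColor-absent c G (λ e∈G e≡c → c∉G (lose e∈G e≡c)))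

-- 'Joins e u w': the edge e can be traversed from u to w.
record Incidence (n : ℕ) : Set₁ where
  field
    Joins  : Edge n → Fin n → Fin n → Set
    joins? : ∀ e u w → Dec (Joins e u w)
    joins-unique : ∀ {e x y x′ y′} → Joins e x y → Joins e x′ y′ → (x ≡ x′ × y ≡ y′) ⊎ (x ≡ y′ × y ≡ x′)

incidence : ∀ {n} → Bool → Incidence n
incidence true = record
  { Joins = λ e u w → src e ≡ u × tgt e ≡ w
  ; joins? = λ e u w → (src e Fin.≟ u) ×-dec (tgt e Fin.≟ w)
  ; joins-unique = λ { (refl , refl) (refl , refl) → inj₁ (refl , refl) }
  }
incidence false = record
  { Joins = λ e u w → (src e ≡ u × tgt e ≡ w) ⊎ (src e ≡ w × tgt e ≡ u)
  ; joins? = λ e u w → ((src e Fin.≟ u) ×-dec (tgt e Fin.≟ w)) ⊎-dec ((src e Fin.≟ w) ×-dec (tgt e Fin.≟ u))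
  ; joins-unique = λ
    { (inj₁ (refl , refl)) (inj₁ (refl , refl)) → inj₁ (refl , refl)
    ; (inj₁ (refl , refl)) (inj₂ (refl , refl)) → inj₂ (refl , refl)
    ; (inj₂ (refl , refl)) (inj₁ (refl , refl)) → inj₂ (refl , refl)
    ; (inj₂ (refl , refl)) (inj₂ (refl , refl)) → inj₁ (refl , refl) }
  }

-- Reverses all traversals without touching the edge list, so that a preserver for V × R also yields
-- one for R × V.
opposite : ∀ {n} → Incidence n → Incidence n
opposite I = record
  { Joins = λ e u w → Joins e w u
  ; joins? = λ e u w → joins? e w u
  ; joins-unique = λ j j′ → swapped (joins-unique j j′)
  }
  where
  open Incidence I
  swapped : ∀ {x y x′ y′ : Fin _} → (x ≡ x′ × y ≡ y′) ⊎ (x ≡ y′ × y ≡ x′) → (y ≡ y′ × x ≡ x′) ⊎ (y ≡ x′ × x ≡ y′)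
  swapped (inj₁ (p , q)) = inj₁ (q , p)
  swapped (inj₂ (p , q)) = inj₂ (q , p)

module Distance {n : ℕ} (I : Incidence n) where

  open Incidence I

  -- A `Walk` that records its edges and treats directed and undirected graphs alike through
  -- `Joins`. Vertices may repeat.
  data Path (E : List (Edge n)) : Fin n → Fin n → ℕ → Set where
    stop : ∀ {s} → Path E s s 0
    step : ∀ {s u t k} (e : Edge n) → e ∈ E → Joins e s u → Path E u t k → Path E s t (suc k)

  private variable
    E F : List (Edge n)
    s t u v w : Fin n
    j k m : ℕ

  edges : Path E s t k → List (Edge n)
  edges stop           = []
  edges (step e _ _ p) = e ∷ edges p

  -- The start is left out: a vertex found here is reached by at least one edge, which `level` needs
  -- to speak of a first edge towards it.
  successors : Path E s t k → List (Fin n)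
  successors stop                   = []
  successors (step {u = u} _ _ _ p) = u ∷ successors p

  length-edges : (p : Path E s t k) → length (edges p) ≡ k
  length-edges stop           = refl
  length-edges (step _ _ _ p) = cong suc (length-edges p)

  length-successors : (p : Path E s t k) → length (successors p) ≡ k
  length-successors stop           = refl
  length-successors (step _ _ _ p) = cong suc (length-successors p)

  edges⊆ : (p : Path E s t k) {e : Edge n} → e ∈ edges p → e ∈ E
  edges⊆ (step _ e∈ _ p) (here refl) = e∈
  edges⊆ (step _ _  _ p) (there e∈)  = edges⊆ p e∈

  transport : (p : Path E s t k) → (∀ {e} → e ∈ edges p → e ∈ F) → Path F s t k
  transport stop           sub = stop
  transport (step e _ j p) sub = step e (sub (here refl)) j (transport p (sub ∘ there))

  edges-transport : (p : Path E s t k) (sub : ∀ {e} → e ∈ edges p → e ∈ F) → edges (transport p sub) ≡ edges p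
  edges-transport stop           sub = refl
  edges-transport (step e _ _ p) sub = cong (e ∷_) (edges-transport p (sub ∘ there))

  path-mono : (∀ {e} → e ∈ E → e ∈ F) → Path E s t k → Path F s t k
  path-mono sub p = transport p (sub ∘ edges⊆ p)

  _++ₚ_ : Path E s u j → Path E u t k → Path E s t (j + k)
  stop          ++ₚ q = q
  step e e∈ j p ++ₚ q = step e e∈ j (p ++ₚ q)

  _∷ʳₚ_ : Path E s u k → ∃[ e ] (e ∈ E × Joins e u t) → Path E s t (suc k)
  stop          ∷ʳₚ (e , e∈ , j) = step e e∈ j stop
  step f f∈ i p ∷ʳₚ last         = step f f∈ i (p ∷ʳₚ last)

  abstract

    path? : ∀ E s t k → Dec (Path E s t k)
    path? E s t zero = map′ (λ { refl → stop }) (λ { stop → refl }) (s Fin.≟ t)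
    path? E s t (suc k) = map′ to from (any? (λ e → Fin.any? (λ u → joins? e s u ×-dec path? E u t k)) E)
      where
      First : Edge n → Set
      First e = ∃[ u ] (Joins e s u × Path E u t k)
      to : Any First E → Path E s t (suc k)
      to a = let e , e∈ , _ , i , p = find a in step e e∈ i p
      from : Path E s t (suc k) → Any First E
      from (step e e∈ i p) = lose e∈ (_ , i , p)

  -- A relation rather than a function, since an unreachable target has no distance.
  Dist : List (Edge n) → Fin n → Fin n → ℕ → Set
  Dist E s t k = Path E s t k × (∀ {j} → Path E s t j → k ≤ j)

  dist-unique : Dist E s t j → Dist E s t k → j ≡ k
  dist-unique (p , p-min) (q , q-min) = ≤-antisym (p-min q) (q-min p)

  abstract

    path⇒dist : Path E s t k → ∃[ m ] (m ≤ k × Dist E s t m)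
    path⇒dist {E} {s} {t} {k} = <-rec (λ k → Path E s t k → ∃[ m ] (m ≤ k × Dist E s t m)) go k
      where
      go : ∀ k → (∀ {j} → j < k → Path E s t j → ∃[ m ] (m ≤ j × Dist E s t m)) → Path E s t k → ∃[ m ] (m ≤ k × Dist E s t m)
      go k rec p with anyUpTo? (path? E s t) k
      ... | yes (j , j<k , q) = let m , m≤j , d = rec j<k q in m , ≤-trans m≤j (<⇒≤ j<k) , d
      ... | no  none = k , ≤-refl , p , λ q → ≮⇒≥ (λ j<k → none (_ , j<k , q))

  dist-prefix : Dist E s t m → Path E s u j → Path E u t k → j + k ≡ m → Dist E s u j
  dist-prefix {k = k} (_ , min) p q refl = p , λ p′ → +-cancelʳ-≤ k _ _ (min (p′ ++ₚ q))

  dist-suffix : Dist E s t m → Path E s u j → Path E u t k → j + k ≡ m → Dist E u t k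
  dist-suffix {j = j} (_ , min) p q refl = q , λ q′ → +-cancelˡ-≤ j _ _ (min (p ++ₚ q′))

  locate-successor : ∀ (p : Path E s t m) L {x} → x ∈ take L (successors p) →
    ∃[ j ] ∃[ k ] (Path E s x (suc j) × Path E x t k × suc j + k ≡ m × suc j ≤ L)
  locate-successor (step e e∈ i p) (suc L) (here refl) = 0 , _ , step e e∈ i stop , p , refl , s≤s z≤n
  locate-successor (step e e∈ i p) (suc L) (there x∈) with locate-successor p L x∈
  ... | j , k , q , r , refl , j<L = suc j , k , step e e∈ i q , r , refl , s≤s j<L

  locate-edge : ∀ (p : Path E s t m) {e} → e ∈ edges p →
    ∃[ x ] ∃[ y ] ∃[ j ] ∃[ k ] (Joins e x y × Path E s x j × Path E y t k × j + suc k ≡ m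
      × (∀ {L} → j < L → e ∈ take L (edges p)))
  locate-edge (step e e∈ i p) (here refl) = _ , _ , 0 , _ , i , stop , p , refl , λ { (s≤s _) → here refl }
  locate-edge (step e e∈ i p) (there f∈) with locate-edge p f∈
  ... | x , y , j , k , i′ , q , r , refl , close = x , y , suc j , k , i′ , step e e∈ i q , r , refl ,
    λ { (s≤s j<L) → there (close j<L) }

  -- Cutting out the closed part between two visits to a vertex would shorten the path.
  shortest⇒unique : (d : Dist E s t m) → Unique (s ∷ successors (proj₁ d))
  shortest⇒unique (stop , _) = [] ∷ []
  shortest⇒unique {E} {s} (p₀@(step {u = u} {k = k} e e∈ i p) , min) = All.tabulate s∉ ∷ shortest⇒unique (dist-suffix (p₀ , min) (step e e∈ i stop) p refl)
    where
    s∉ : ∀ {x} → x ∈ u ∷ successors p → s ≢ x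
    s∉ x∈ refl with locate-successor p₀ (suc k) (subst (s ∈_) (sym (take-all (suc k) _ (≤-reflexive (length-successors p₀)))) x∈)
    ... | j , l , _ , r , eq , _ = <⇒≱ (≤-trans (s≤s (m≤n+m l j)) (≤-reflexive eq)) (min r)

  -- A shortest path has `suc m` distinct vertices. The bound makes the search in `dist?` finite.
  dist<n : Dist E s t m → m < n
  dist<n {m = m} d@(p , _) = begin
    suc m                       ≡⟨ cong suc (length-successors p) ⟨
    suc (length (successors p)) ≤⟨ unique⇒length≤ (shortest⇒unique d) (λ _ → ∈-allFin _) ⟩
    length (allFin n)           ≡⟨ length-allFin n ⟩
    n                           ∎
    where open ≤-Reasoning

  abstract

    dist? : ∀ E s t → Dec (∃ (Dist E s t))
    dist? E s t with anyUpTo? (path? E s t) n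
    ... | yes (_ , _ , p) = let m , _ , d = path⇒dist p in yes (m , d)
    ... | no  none        = no λ (m , d) → none (m , dist<n d , proj₁ d)

-- Reversal, and translation between walks and paths

module _ {n : ℕ} (I : Incidence n) where

  open Distance

  reverse : ∀ {E s t k} → Path I E s t k → Path (opposite I) E t s k
  reverse stop            = stop
  reverse (step e e∈ j p) = _∷ʳₚ_ (opposite I) (reverse p) (e , e∈ , j)

  reverse⁻ : ∀ {E s t k} → Path (opposite I) E s t k → Path I E t s k
  reverse⁻ stop            = stop
  reverse⁻ (step e e∈ j p) = _∷ʳₚ_ I (reverse⁻ p) (e , e∈ , j)

  reverse-dist : ∀ {E s t k} → Dist I E s t k → Dist (opposite I) E t s k
  reverse-dist (p , min) = reverse p , λ q → min (reverse⁻ q)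

walk⇒path : ∀ {n} d {E : List (Edge n)} {s t k} → Walk d E s t k → Distance.Path (incidence d) E s t k
walk⇒path d here = Distance.stop
walk⇒path true  (there (_ , e∈) w)      = Distance.step _ e∈ (refl , refl) (walk⇒path true w)
walk⇒path false (there (_ , inj₁ e∈) w) = Distance.step _ e∈ (inj₁ (refl , refl)) (walk⇒path false w)
walk⇒path false (there (_ , inj₂ e∈) w) = Distance.step _ e∈ (inj₂ (refl , refl)) (walk⇒path false w)

path⇒walk : ∀ {n} d {E : List (Edge n)} {s t k} → Distance.Path (incidence d) E s t k → Walk d E s t k
path⇒walk d Distance.stop = here
path⇒walk true  (Distance.step e e∈ (refl , refl) p)        = there (_ , e∈) (path⇒walk true p)
path⇒walk false (Distance.step e e∈ (inj₁ (refl , refl)) p) = there (_ , inj₁ e∈) (path⇒walk false p)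
path⇒walk false (Distance.step e e∈ (inj₂ (refl , refl)) p) = there (_ , inj₂ e∈) (path⇒walk false p)

-- Equal ordered endpoints give a `SameLink` in the directed and the undirected case alike.
-- Distinctness of these pairs bounds the number of edges by n² and excludes repetitions in `G`.
simple⇒unique-pairs : ∀ {n} d {G : List (Edge n)} → Simple d G → Unique (map (λ e → src e , tgt e) G)
simple⇒unique-pairs d {[]} _ = []
simple⇒unique-pairs d {e ∷ G} (_ ∷ loopless , distinct ∷ simple) =
  All.tabulate new ∷ simple⇒unique-pairs d (loopless , simple)
  where
  same : ∀ d f → (src e , tgt e) ≡ (src f , tgt f) → SameLink d e f
  same true  _ refl = refl , refl
  same false _ refl = inj₁ (refl , refl)
  new : ∀ {x} → x ∈ map (λ e → src e , tgt e) G → (src e , tgt e) ≢ x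
  new x∈ eq with f , f∈G , refl ← ∈-map⁻ (λ e → src e , tgt e) x∈ = All.lookup distinct f∈G (same d f eq)

-- Replacement paths

length-take≤ : {A : Set} (k : ℕ) (xs : List A) → length (take k xs) ≤ k
length-take≤ k xs = ≤-trans (≤-reflexive (length-take k xs)) (m⊓n≤m k (length xs))

module Replacement {n : ℕ} (I : Incidence n) (G : List (Edge n)) where

  open Incidence I
  open Distance I

  deleteColor⊆ : ∀ {c e} → e ∈ deleteColor c G → e ∈ G
  deleteColor⊆ = proj₁ ∘ ∈-deleteColor⁻ G

  module _ (L : ℕ) (1≤L : 1 ≤ L) where

    open HittingSet n L 1≤L

    prefix : List (Edge n) → Fin n → Fin n → List (List (Fin n))
    prefix X s t with dist? X s t
    ... | no _ = []
    ... | yes (m , p , _) with L ≤? m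
    ... | no  _ = []
    ... | yes _ = [ take L (successors p) ]

    length-prefix : ∀ X s t → length (prefix X s t) ≤ 1
    length-prefix X s t with dist? X s t
    ... | no _ = z≤n
    ... | yes (m , p , _) with L ≤? m
    ... | no  _ = z≤n
    ... | yes _ = ≤-refl

    prefix-large : ∀ X s t {S} → S ∈ prefix X s t → Large S
    prefix-large X s t S∈ with dist? X s t
    ... | yes (m , d) with L ≤? m
    prefix-large X s t (here refl) | yes (m , d) | yes L≤m with shortest⇒unique d
    ... | _ ∷ uniq = Unique.take⁺ L uniq , ≤-reflexive (sym (trans (length-take L _)
      (m≤n⇒m⊓n≡m (subst (L ≤_) (sym (length-successors (proj₁ d))) L≤m))))

    -- The path chosen by `dist?` may differ from the one inside the given `Dist`; only the length
    -- agrees, hence the existential.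
    prefix-complete : ∀ {X s t m} → Dist X s t m → L ≤ m → ∃[ p ] (take L (successors {X} {s} {t} {m} p) ∈ prefix X s t)
    prefix-complete {X} {s} {t} {m} d L≤m with dist? X s t
    ... | no none = contradiction (m , d) none
    ... | yes (m′ , d′) with refl ← dist-unique d′ d with L ≤? m
    ... | no L≰m = contradiction L≤m L≰m
    ... | yes _  = proj₁ d′ , here refl

    prefixesFrom : List (Edge n) → Fin n → List (List (Fin n))
    prefixesFrom X s = concatMap (prefix X s) (allFin n)

    prefixesIn : List (Edge n) → List (List (Fin n))
    prefixesIn X = concatMap (prefixesFrom X) (allFin n)

    prefixes : List (List (Fin n))
    prefixes = concatMap prefixesIn (deletions G)

    length-prefixesFrom : ∀ X s → length (prefixesFrom X s) ≤ n
    length-prefixesFrom X s = ≤-trans (length-concatMap≤ (prefix X s) (length-prefix X s) (allFin n))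
      (≤-reflexive (trans (*-identityʳ _) (length-allFin n)))

    length-prefixesIn : ∀ X → length (prefixesIn X) ≤ n * n
    length-prefixesIn X = ≤-trans (length-concatMap≤ (prefixesFrom X) (length-prefixesFrom X) (allFin n))
      (≤-reflexive (cong (_* n) (length-allFin n)))

    length-prefixes : length prefixes ≤ suc (length G) * (n * n)
    length-prefixes = ≤-trans (length-concatMap≤ prefixesIn length-prefixesIn (deletions G))
      (≤-reflexive (cong (λ g → suc g * (n * n)) (length-map _ G)))

    ∈-prefixes⁺ : ∀ {X s t S} → X ∈ deletions G → S ∈ prefix X s t → S ∈ prefixes
    ∈-prefixes⁺ {X} {s} {t} X∈ S∈ = ∈-concatMap⁺ prefixesIn (lose X∈
      (∈-concatMap⁺ (prefixesFrom X) (lose (∈-allFin s) (∈-concatMap⁺ (prefix X s) (lose (∈-allFin t) S∈)))))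

    prefixes-large : All Large prefixes
    prefixes-large = All.tabulate large
      where
      large : ∀ {S} → S ∈ prefixes → Large S
      large S∈ with X , _ , S∈X ← find (∈-concatMap⁻ prefixesIn {xs = deletions G} S∈)
        with s , _ , S∈s ← find (∈-concatMap⁻ (prefixesFrom X) {xs = allFin n} S∈X)
        with t , _ , S∈t ← find (∈-concatMap⁻ (prefix X s) {xs = allFin n} S∈s) = prefix-large X s t S∈t

    abstract

      -- One hitting set serves all colors and all pairs at once, as only (|G| + 1) n² prefixes have
      -- to be hit. The vertex found lies at positive distance at most `L` from `s` in the graph
      -- without color `c`.
      hitPaths : ∀ b → suc (length G) * (n * n) < 2 ^ b → ∃[ R ] (length R * L ≤ 2 * n * b ×
        (∀ {c s t m} → Dist (deleteColor c G) s t m → L ≤ m → ∃[ r ] ∃[ j ] ∃[ k ] (r ∈ R ×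
          Path (deleteColor c G) s r (suc j) × Path (deleteColor c G) r t k × suc j + k ≡ m × suc j ≤ L)))
      hitPaths b small with hittingSet b prefixes prefixes-large (≤-<-trans length-prefixes small)
      ... | R , cost , hit = R , cost , λ {c} d L≤m →
        let p , S∈ = prefix-complete d L≤m
            r , r∈R , r∈S = hit (∈-prefixes⁺ (deleteColor∈deletions c G) S∈)
            j , k , q , q′ , eq , j<L = locate-successor p L r∈S
        in r , j , k , r∈R , q , q′ , eq , j<L

  route : List (Edge n) → Fin n → Fin n → List (Edge n)
  route X s t with dist? X s t
  ... | no _            = []
  ... | yes (_ , p , _) = edges p

  route-path : ∀ {X s t m} → Dist X s t m → ∃[ p ] (route X s t ≡ edges {X} {s} {t} {m} p)
  route-path {X} {s} {t} {m} d with dist? X s t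
  ... | no none = contradiction (m , d) none
  ... | yes (m′ , d′) with refl ← dist-unique d′ d = proj₁ d′ , refl

  detour : ℕ → Fin n → Fin n → Edge n → List (Edge n)
  detour a s t e = take a (route (deleteColor (color e) G) s t)

  -- Used with `a` equal to 1 to collect first edges out of a source, and with `a` above the
  -- distance to collect whole paths of close pairs.
  recover : ℕ → ℕ → Fin n → Fin n → List (Edge n)
  recover a L s t = take a (route G s t) ++
    concatMap (detour a s t) (take L (route G s t))

  length-recover : ∀ a L s t → length (recover a L s t) ≤ a + L * a
  length-recover a L s t = begin
    length (recover a L s t)                ≡⟨ length-++ (take a (route G s t)) ⟩
    length (take a (route G s t)) + _       ≤⟨ +-mono-≤ (length-take≤ a _) (≤-trans
                                                 (length-concatMap≤ (detour a s t) (λ e → length-take≤ a _) (take L (route G s t)))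
                                                 (*-monoˡ-≤ a (length-take≤ L (route G s t)))) ⟩
    a + L * a                               ∎
    where open ≤-Reasoning

  -- The position, counted from 0, of `e` on a shortest path of `G` from `s`.
  EdgeAt : Fin n → ℕ → Edge n → Set
  EdgeAt s j e = ∃[ x ] ∃[ y ] (Joins e x y × Dist G s x j × Dist G s y (suc j))

  -- An edge fixes its ends up to order, and in the opposite order the distance from `s` would have
  -- to decrease along it.
  edgeAt-unique : ∀ {s i j e} → EdgeAt s i e → EdgeAt s j e → i ≡ j
  edgeAt-unique (x , y , i , dx , dy) (x′ , y′ , i′ , dx′ , dy′) with joins-unique i i′
  ... | inj₁ (refl , refl) = dist-unique dx dx′
  ... | inj₂ (refl , refl) with refl ← dist-unique dx dy′ = contradiction (dist-unique dy dx′) λ ()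

  -- Three cases for the chosen shortest path of `G`: it avoids color `c` and survives; or the edge
  -- of color `c` found on it is among its first `L`, and the replacement path is a recorded detour;
  -- or that edge lies deeper, which is the second alternative.
  recover-spec : ∀ a L {c s t m m₀} → Dist G s t m₀ → Dist (deleteColor c G) s t m →
    (∃[ p ] (∀ {e} → e ∈ take a (edges {deleteColor c G} {s} {t} {m} p) → e ∈ recover a L s t))
    ⊎ (∃[ e ] ∃[ j ] (e ∈ G × color e ≡ c × EdgeAt s j e × L ≤ j × j < m₀))
  recover-spec a L {c} {s} {t} {m} {m₀} d₀ d with route-path d₀
  ... | p₀ , eq with any? (λ e → color e ≟ c) (edges p₀)
  -- Deletion cannot shorten distances, and here `p₀` survives it, so `m₀` and `m` agree.
  ... | no c∉p₀ = inj₁ (surviving (≤-antisym (proj₂ d₀ (path-mono deleteColor⊆ (proj₁ d))) (proj₂ d (transport p₀ avoids))))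
    where
    avoids : ∀ {e} → e ∈ edges p₀ → e ∈ deleteColor c G
    avoids e∈ = ∈-deleteColor⁺ (edges⊆ p₀ e∈) (λ e≡c → c∉p₀ (lose e∈ e≡c))
    surviving : m₀ ≡ m → ∃[ p ] (∀ {e} → e ∈ take a (edges {deleteColor c G} {s} {t} {m} p) → e ∈ recover a L s t)
    surviving refl = transport p₀ avoids ,
      λ e∈ → ∈-++⁺ˡ (subst (λ es → _ ∈ take a es) (trans (edges-transport p₀ avoids) (sym eq)) e∈)
  ... | yes c∈p₀ with find c∈p₀
  ... | e , e∈p₀ , refl with locate-edge p₀ e∈p₀
  ... | x , y , j , k , i , q , q′ , eq′ , near with j <? L
  ... | no j≮L = inj₂ (e , j , edges⊆ p₀ e∈p₀ , refl ,
      (x , y , i , dist-prefix d₀ q (step e e∈G i q′) eq′ , dist-prefix d₀ (q ∷ʳₚ (e , e∈G , i)) q′ (trans (sym (+-suc j k)) eq′)) ,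
      ≮⇒≥ j≮L , ≤-trans (m≤m+n (suc j) k) (≤-reflexive (trans (sym (+-suc j k)) eq′)))
    where
    e∈G : e ∈ G
    e∈G = edges⊆ p₀ e∈p₀
  ... | yes j<L with route-path d
  ... | p , eq″ = inj₁ (p , λ f∈ → ∈-++⁺ʳ (take a (route G s t)) (∈-concatMap⁺ (detour a s t)
      (lose (subst (λ es → e ∈ take L es) (sym eq) (near j<L)) (subst (λ es → _ ∈ take a es) (sym eq″) f∈))))

  -- Shortest paths of G of length at most m₀ from v are too short to use the edges in K.
  Exhausted : Fin n → ℕ → ℕ → List (Edge n) → Set
  Exhausted v c m₀ K = Unique K × All (λ e → e ∈ G × color e ≡ c × (∃[ j ] (EdgeAt v j e × m₀ ≤ j))) K

  Departs : List (Edge n) → List (Edge n) → Fin n → Fin n → ℕ → Set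
  Departs F X v r m = ∃[ e ] ∃[ u ] (e ∈ F × e ∈ X × Joins e v u × Path X u r m)

  -- Preservers for all pairs with target in a small set

  module Sourcewise (Δ ρ b : ℕ) (1≤ρ : 1 ≤ ρ)
    (class≤Δ : ∀ c → length (colorClass c G) ≤ Δ) (small : suc (length G) * (n * n) < 2 ^ b) where

    B : ℕ
    B = 2 * n * b

    1≤ρ^ : ∀ k → 1 ≤ ρ ^ k
    1≤ρ^ k = subst (_≤ ρ ^ k) (^-zeroˡ k) (^-monoˡ-≤ k 1≤ρ)

    exhausted≤Δ : ∀ {v c m₀ K} → Exhausted v c m₀ K → length K ≤ Δ
    exhausted≤Δ {c = c} (uniq , all) = ≤-trans
      (unique⇒length≤ uniq (λ e∈ → let e∈G , e≡c , _ = All.lookup all e∈ in ∈-colorClass⁺ e∈G e≡c)) (class≤Δ c)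

    exhaust : ∀ {v c m₀ m₁ j e K} → Exhausted v c m₀ K → e ∈ G → color e ≡ c → EdgeAt v j e → m₁ ≤ j → j < m₀ →
      Exhausted v c m₁ (e ∷ K)
    exhaust {v} {c} {m₀} {m₁} {j} {e} {K} (uniq , all) e∈G e≡c at m₁≤j j<m₀ =
      All.tabulate new ∷ uniq ,
      (e∈G , e≡c , j , at , m₁≤j) ∷
        All.map (λ (f∈G , f≡c , i , at′ , m₀≤i) → f∈G , f≡c , i , at′ , ≤-trans m₁≤j (<⇒≤ (<-≤-trans j<m₀ m₀≤i))) all
      where
      new : ∀ {f} → f ∈ K → e ≢ f
      new f∈K refl with All.lookup all f∈K
      ... | _ , _ , i , at′ , m₀≤i = <⇒≢ (<-≤-trans j<m₀ m₀≤i) (edgeAt-unique at at′)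

    -- `Δ ≤ length K + k` says that at most `k` edges of color `c` are not yet exhausted. `F` is
    -- chosen before `c` and `K`, so it serves all colors.
    Level : Fin n → ℕ → List (Fin n) → Set
    Level v k R = ∃[ F ] (length F * ρ ≤ suc k * (2 * B) ×
      (∀ {r c m m₀ K} → r ∈ R → Dist G v r m₀ → Exhausted v c m₀ K → Δ ≤ length K + k →
        Dist (deleteColor c G) v r (suc m) → Departs F (deleteColor c G) v r m))

    recovered : Fin n → ℕ → List (Fin n) → List (Edge n)
    recovered v L R = concatMap (recover 1 L v) R

    -- Each target costs at most 1 + ρ^k ≤ 2ρ^k edges and there are at most B/ρ^(k+1) targets: a
    -- total of 2B/ρ, the same at every scale.
    length-recovered : ∀ v k R → length R * ρ ^ suc k ≤ B → length (recovered v (ρ ^ k) R) * ρ ≤ 2 * B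
    length-recovered v k R few = begin
      length (recovered v L R) * ρ   ≤⟨ *-monoˡ-≤ ρ (length-concatMap≤ (recover 1 L v) (length-recover 1 L v) R) ⟩
      length R * (1 + L * 1) * ρ     ≤⟨ *-monoˡ-≤ ρ (*-monoʳ-≤ (length R) (+-monoˡ-≤ (L * 1) (1≤ρ^ k))) ⟩
      length R * (L + L * 1) * ρ     ≡⟨ rearrange (length R) L ρ ⟩
      2 * (length R * (ρ * L))       ≤⟨ *-monoʳ-≤ 2 few ⟩
      2 * B                          ∎
      where
      open ≤-Reasoning
      L = ρ ^ k
      rearrange : ∀ r l p → r * (l + l * 1) * p ≡ 2 * (r * (p * l))
      rearrange = solve-∀

    abstract

      departs-or-deep : ∀ {v r c m m₀} L R → r ∈ R → Dist G v r m₀ → Dist (deleteColor c G) v r (suc m) →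
        Departs (recovered v L R) (deleteColor c G) v r m
        ⊎ (∃[ e ] ∃[ j ] (e ∈ G × color e ≡ c × EdgeAt v j e × L ≤ j × j < m₀))
      departs-or-deep L R r∈R d₀ d with recover-spec 1 L d₀ d
      ... | inj₁ (step e e∈ i p , first) = inj₁ (e , _ , ∈-concatMap⁺ (recover 1 L _) (lose r∈R (first (here refl))) , e∈ , i , p)
      ... | inj₂ deep                    = inj₂ deep

    -- An edge of color c lying beyond the first ρ^k edges of the shortest path is out of reach for the
    -- vertices hit within distance ρ^k, so every level uses up one of the at most Δ edges of color c.
    level : ∀ v k R → length R * ρ ^ suc k ≤ B → Level v k R
    level v zero R few = recovered v 1 R , ≤-trans (length-recovered v 0 R few) (m≤m+n (2 * B) 0) ,
      λ r∈R d₀ ex Δ≤ d → ok r∈R d₀ ex Δ≤ d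
      where
      ok : ∀ {r c m m₀ K} → r ∈ R → Dist G v r m₀ → Exhausted v c m₀ K → Δ ≤ length K + 0 →
        Dist (deleteColor c G) v r (suc m) → Departs (recovered v 1 R) (deleteColor c G) v r m
      ok {K = K} r∈R d₀ ex Δ≤ d with departs-or-deep 1 R r∈R d₀ d
      ... | inj₁ departs = departs
      -- All Δ edges of color `c` are exhausted already, so one more is impossible.
      ... | inj₂ (e , j , e∈G , e≡c , at , _ , j<m₀) =
        contradiction (≤-trans (exhausted≤Δ (exhaust ex e∈G e≡c at ≤-refl j<m₀)) (subst (Δ ≤_) (+-identityʳ _) Δ≤)) (<⇒≱ ≤-refl)
    level v (suc k) R few with hitPaths (ρ ^ suc k) (1≤ρ^ (suc k)) b small
    ... | R′ , few′ , hit with level v k R′ few′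
    ... | F , cost , departs′ = recovered v L R ++ F , cost′ , ok
      where
      L = ρ ^ suc k
      cost′ : length (recovered v L R ++ F) * ρ ≤ suc (suc k) * (2 * B)
      cost′ = begin
        length (recovered v L R ++ F) * ρ         ≡⟨ cong (_* ρ) (length-++ (recovered v L R)) ⟩
        (length (recovered v L R) + length F) * ρ ≡⟨ *-distribʳ-+ ρ (length (recovered v L R)) (length F) ⟩
        length (recovered v L R) * ρ + length F * ρ ≤⟨ +-mono-≤ (length-recovered v (suc k) R few) cost ⟩
        2 * B + suc k * (2 * B)                   ∎
        where open ≤-Reasoning
      ok : ∀ {r c m m₀ K} → r ∈ R → Dist G v r m₀ → Exhausted v c m₀ K → Δ ≤ length K + suc k →
        Dist (deleteColor c G) v r (suc m) → Departs (recovered v L R ++ F) (deleteColor c G) v r m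
      ok {K = K} r∈R d₀ ex Δ≤ d with departs-or-deep L R r∈R d₀ d
      ... | inj₁ (e , u , e∈F , e∈X , i , p) = e , u , ∈-++⁺ˡ e∈F , e∈X , i , p
      ... | inj₂ (e , j , e∈G , e≡c , at , L≤j , j<m₀)
        -- The replacement path is long enough to be hit: `L ≤ j < m₀`, and `m₀` is at most its
        -- length.
        with hit d (≤-trans L≤j (≤-trans (<⇒≤ j<m₀) (proj₂ d₀ (path-mono deleteColor⊆ (proj₁ d)))))
      ... | r′ , j′ , k′ , r′∈R′ , q , q′ , refl , j′<L with path⇒dist (path-mono deleteColor⊆ q)
      -- In `G` the vertex `r′` is at distance at most `L ≤ j`, so `e` is exhausted for it and one
      -- unit of `k` is released.
      ... | m₁ , m₁≤ , d₁ with departs′ r′∈R′ d₁ (exhaust ex e∈G e≡c at (≤-trans m₁≤ (≤-trans j′<L L≤j)) j<m₀)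
                                (subst (Δ ≤_) (+-suc (length K) k) Δ≤) (dist-prefix d q q′ refl)
      -- A shortest path to `r′` starting with a kept edge is continued by the old path from `r′` to
      -- `r`; the total length is unchanged.
      ... | f , u , f∈F , f∈X , i , p = f , u , ∈-++⁺ʳ (recovered v L R) f∈F , f∈X , i , p ++ₚ q′

    -- Induction on the distance: behind the kept first edge there remains a shortest path to the
    -- same `r`, and the edges kept for its first vertex take over.
    sourcewise : ∀ R → length R * ρ ^ suc Δ ≤ B → ∃[ F ] (length F * ρ ≤ n * (suc Δ * (2 * B)) ×
      (∀ {H} → (∀ {e} → e ∈ F → e ∈ G → e ∈ H) → ∀ {v r c m} → r ∈ R →
        Dist (deleteColor c G) v r m → Path (deleteColor c H) v r m))
    sourcewise R few = concatMap F (allFin n) , cost , λ sub → path sub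
      where
      F : Fin n → List (Edge n)
      F v = proj₁ (level v Δ R few)
      cost : length (concatMap F (allFin n)) * ρ ≤ n * (suc Δ * (2 * B))
      cost = ≤-trans (length-concatMap*≤ F ρ (λ v → proj₁ (proj₂ (level v Δ R few))) (allFin n))
        (≤-reflexive (cong (_* (suc Δ * (2 * B))) (length-allFin n)))
      path : ∀ {H} → (∀ {e} → e ∈ concatMap F (allFin n) → e ∈ G → e ∈ H) → ∀ {v r c m} → r ∈ R →
        Dist (deleteColor c G) v r m → Path (deleteColor c H) v r m
      path sub {m = zero} r∈R (stop , _) = stop
      path sub {v} {m = suc m} r∈R d with path⇒dist (path-mono deleteColor⊆ (proj₁ d))
      -- At the top level nothing is exhausted: `K` is empty and `k` is `Δ`.
      ... | _ , _ , d₀ with proj₂ (proj₂ (level v Δ R few)) r∈R d₀ ([] , []) ≤-refl d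
      ... | e , u , e∈F , e∈X , i , p = step e
        (∈-deleteColor⁺ (sub (∈-concatMap⁺ F (lose (∈-allFin v) e∈F)) (proj₁ (∈-deleteColor⁻ G e∈X))) (proj₂ (∈-deleteColor⁻ G e∈X)))
        i (path sub r∈R (dist-suffix d (step e e∈X i stop) p refl))

-- Pairwise preservers

-- Stated for every `H` containing the edges of `G` that lie in `F`, because `H` will be obtained by
-- filtering `G`. The factor `ρ` on the left avoids division.
pairwise : ∀ {n} (I : Incidence n) (G : List (Edge n)) Δ ρ b → 1 ≤ ρ → (∀ c → length (colorClass c G) ≤ Δ) →
  suc (length G) * (n * n) < 2 ^ b → (P : List (Fin n × Fin n)) →
  ∃[ F ] (length F * ρ ≤ 2 * (length P * (ρ * (ρ ^ suc Δ * ρ ^ suc Δ))) + 2 * (n * (suc Δ * (2 * (2 * n * b)))) ×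
    (∀ {H} → (∀ {e} → e ∈ F → e ∈ G → e ∈ H) → ∀ {c s t m} → (s , t) ∈ P →
      Distance.Dist I (deleteColor c G) s t m → Distance.Path I (deleteColor c H) s t m))
pairwise {n} I G Δ ρ b 1≤ρ class≤Δ small P = F , cost , keep
  where
  open Distance I
  open Replacement I G
  open Sourcewise Δ ρ b 1≤ρ class≤Δ small
  -- In the reversed graph the same hitting set is again the set of targets, which covers R × V.
  module Backward = Replacement.Sourcewise (opposite I) G Δ ρ b 1≤ρ class≤Δ small

  ℓ T : ℕ
  ℓ = ρ ^ suc Δ
  T = n * (suc Δ * (2 * B))

  hitting = hitPaths ℓ (1≤ρ^ (suc Δ)) b small
  R = proj₁ hitting

  forward  = sourcewise R (proj₁ (proj₂ hitting))
  backward = Backward.sourcewise R (proj₁ (proj₂ hitting))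

  pairEdges : Fin n × Fin n → List (Edge n)
  pairEdges (s , t) = recover ℓ ℓ s t

  F₁ F₂ F₃ F : List (Edge n)
  F₁ = concatMap pairEdges P
  F₂ = proj₁ forward
  F₃ = proj₁ backward
  F  = F₁ ++ F₂ ++ F₃

  cost₁ : length F₁ * ρ ≤ 2 * (length P * (ρ * (ℓ * ℓ)))
  cost₁ = begin
    length F₁ * ρ                       ≤⟨ *-monoˡ-≤ ρ (length-concatMap≤ pairEdges (λ (s , t) → length-recover ℓ ℓ s t) P) ⟩
    length P * (ℓ + ℓ * ℓ) * ρ          ≤⟨ *-monoˡ-≤ ρ (*-monoʳ-≤ (length P) (+-monoˡ-≤ (ℓ * ℓ) ℓ≤ℓℓ)) ⟩
    length P * (ℓ * ℓ + ℓ * ℓ) * ρ      ≡⟨ rearrange (length P) (ℓ * ℓ) ρ ⟩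
    2 * (length P * (ρ * (ℓ * ℓ)))      ∎
    where
    open ≤-Reasoning
    ℓ≤ℓℓ : ℓ ≤ ℓ * ℓ
    ℓ≤ℓℓ = subst (_≤ ℓ * ℓ) (*-identityʳ ℓ) (*-monoʳ-≤ ℓ (1≤ρ^ (suc Δ)))
    rearrange : ∀ p l r → p * (l + l) * r ≡ 2 * (p * (r * l))
    rearrange = solve-∀

  cost : length F * ρ ≤ 2 * (length P * (ρ * (ℓ * ℓ))) + 2 * T
  cost = begin
    length F * ρ                                    ≡⟨ cong (_* ρ) (trans (length-++ F₁) (cong (length F₁ +_) (length-++ F₂))) ⟩
    (length F₁ + (length F₂ + length F₃)) * ρ       ≡⟨ expand (length F₁) (length F₂) (length F₃) ρ ⟩
    length F₁ * ρ + (length F₂ * ρ + (length F₃ * ρ + 0)) ≤⟨ +-mono-≤ cost₁ (+-mono-≤ (proj₁ (proj₂ forward))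
                                                             (+-monoˡ-≤ 0 (proj₁ (proj₂ backward)))) ⟩
    2 * (length P * (ρ * (ℓ * ℓ))) + 2 * T          ∎
    where
    open ≤-Reasoning
    expand : ∀ a b c r → (a + (b + c)) * r ≡ a * r + (b * r + (c * r + 0))
    expand = solve-∀

  keep : ∀ {H} → (∀ {e} → e ∈ F → e ∈ G → e ∈ H) → ∀ {c s t m} → (s , t) ∈ P →
    Dist (deleteColor c G) s t m → Path (deleteColor c H) s t m
  keep sub {c} {s} {t} {m} st∈P d with m <? ℓ
  ... | no m≮ℓ with proj₂ (proj₂ hitting) d (≮⇒≥ m≮ℓ)
  ...   | r , j , k , r∈R , q , q′ , refl , _ =
    proj₂ (proj₂ forward) (sub ∘ ∈-++⁺ʳ F₁ ∘ ∈-++⁺ˡ) r∈R (dist-prefix d q q′ refl) ++ₚ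
    reverse⁻ I (proj₂ (proj₂ backward) (sub ∘ ∈-++⁺ʳ F₁ ∘ ∈-++⁺ʳ F₂) r∈R (reverse-dist I (dist-suffix d q q′ refl)))
  keep sub {c} {s} {t} {m} st∈P d | yes m<ℓ with path⇒dist (path-mono deleteColor⊆ (proj₁ d))
  ... | m₀ , m₀≤m , d₀ with recover-spec ℓ ℓ d₀ d
  -- A close pair has no edge that deep: `j < m₀ ≤ m < ℓ ≤ j` is absurd.
  ... | inj₂ (_ , _ , _ , _ , _ , ℓ≤j , j<m₀) = contradiction (<-≤-trans j<m₀ (≤-trans m₀≤m (<⇒≤ m<ℓ))) (≤⇒≯ ℓ≤j)
  ... | inj₁ (p , p⊆) = transport p λ e∈ →
    let e∈G , e≢c = ∈-deleteColor⁻ G (edges⊆ p e∈) in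
    ∈-deleteColor⁺ (sub (∈-++⁺ˡ (∈-concatMap⁺ pairEdges (lose st∈P (p⊆ (subst (_ ∈_) (sym all-edges) e∈))))) e∈G) e≢c
    where
    all-edges : take ℓ (edges p) ≡ edges p
    all-edges = take-all ℓ (edges p) (subst (_≤ ℓ) (sym (length-edges p)) (<⇒≤ m<ℓ))

-- Logarithms and the choice of `ρ`

n≤2*⌈n/2⌉ : ∀ n → n ≤ 2 * ⌈ n /2⌉
n≤2*⌈n/2⌉ zero          = z≤n
n≤2*⌈n/2⌉ (suc zero)    = s≤s z≤n
n≤2*⌈n/2⌉ (suc (suc n)) = subst (suc (suc n) ≤_) (sym (*-suc 2 ⌈ n /2⌉)) (s≤s (s≤s (n≤2*⌈n/2⌉ n)))

1≤⌈log₂n⌉ : ∀ {n} → 2 ≤ n → 1 ≤ ⌈log₂ n ⌉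
1≤⌈log₂n⌉ = ⌈log₂⌉-mono-≤

n≤2^⌈log₂n⌉ : ∀ n → n ≤ 2 ^ ⌈log₂ n ⌉
n≤2^⌈log₂n⌉ = <-rec (λ n → n ≤ 2 ^ ⌈log₂ n ⌉) go
  where
  go : ∀ n → (∀ {m} → m < n → m ≤ 2 ^ ⌈log₂ m ⌉) → n ≤ 2 ^ ⌈log₂ n ⌉
  go zero    _ = z≤n
  go (suc zero) _ = s≤s z≤n
  go n@(suc (suc n′)) rec = begin
    n                              ≤⟨ n≤2*⌈n/2⌉ n ⟩
    2 * ⌈ n /2⌉                    ≤⟨ *-monoʳ-≤ 2 (rec (⌈n/2⌉<n n′)) ⟩
    2 * 2 ^ ⌈log₂ ⌈ n /2⌉ ⌉        ≡⟨ cong (λ k → 2 ^ suc k) (⌈log₂⌈n/2⌉⌉≡⌈log₂n⌉∸1 n) ⟩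
    2 ^ (1 + (⌈log₂ n ⌉ ∸ 1))      ≡⟨ cong (2 ^_) (m+[n∸m]≡n (1≤⌈log₂n⌉ {n} (s≤s (s≤s z≤n)))) ⟩
    2 ^ ⌈log₂ n ⌉                  ∎
    where open ≤-Reasoning

-- Lets `hitPaths` run with `b = ⌈log₂ n ⌉ * 6`: for N = 2^⌈log₂ n⌉ ≥ 2 the count is at most 2N⁴ ≤
-- N⁵ < N⁶.
few-deletions : ∀ n → 2 ≤ n → suc (n * n) * (n * n) < 2 ^ (⌈log₂ n ⌉ * 6)
few-deletions n 2≤n = begin-strict
  suc (n * n) * (n * n)          ≤⟨ *-mono-≤ (s≤s (*-mono-≤ n≤N n≤N)) (*-mono-≤ n≤N n≤N) ⟩
  (1 + N * N) * (N * N)          ≤⟨ *-monoˡ-≤ (N * N) (+-monoˡ-≤ (N * N) (*-mono-≤ 1≤N 1≤N)) ⟩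
  (N * N + N * N) * (N * N)      ≡⟨ cong (_* (N * N)) (cong (N * N +_) (sym (+-identityʳ (N * N)))) ⟩
  2 * (N * N) * (N * N)          ≤⟨ *-monoˡ-≤ (N * N) (*-monoˡ-≤ (N * N) 2≤N) ⟩
  N * (N * N) * (N * N)          <⟨ m<m*n (N * (N * N) * (N * N)) N 2≤N ⟩
  N * (N * N) * (N * N) * N      ≡⟨ sixth N ⟩
  N ^ 6                          ≡⟨ ^-*-assoc 2 ⌈log₂ n ⌉ 6 ⟩
  2 ^ (⌈log₂ n ⌉ * 6)            ∎
  where
  open ≤-Reasoning
  N : ℕ
  N = 2 ^ ⌈log₂ n ⌉
  n≤N : n ≤ N
  n≤N = n≤2^⌈log₂n⌉ n
  2≤N : 2 ≤ N
  2≤N = ≤-trans 2≤n n≤N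
  1≤N : 1 ≤ N
  1≤N = <⇒≤ 2≤N
  instance
    N≢0 = >-nonZero 1≤N
    M≢0 = >-nonZero (*-mono-≤ (*-mono-≤ 1≤N (*-mono-≤ 1≤N 1≤N)) (*-mono-≤ 1≤N 1≤N))
  sixth : ∀ x → x * (x * x) * (x * x) * x ≡ x * (x * (x * (x * (x * (x * 1)))))
  sixth = solve-∀

-- Searching downwards from `k`, the first success comes directly below a failure.
threshold : ∀ (f : ℕ → ℕ) x k → f 1 ≤ x → x < f (suc k) → ∃[ ρ ] (1 ≤ ρ × f ρ ≤ x × x < f (suc ρ))
threshold f x zero    f1≤x x<f = contradiction f1≤x (<⇒≱ x<f)
threshold f x (suc k) f1≤x x<f with f (suc k) ≤? x
... | yes f≤x = suc k , s≤s z≤n , f≤x , x<f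
... | no  f≰x = threshold f x k f1≤x (≰⇒> f≰x)

^-distribʳ-* : ∀ a b k → (a * b) ^ k ≡ a ^ k * b ^ k
^-distribʳ-* a b zero    = refl
^-distribʳ-* a b (suc k) = trans (cong (a * b *_) (^-distribʳ-* a b k)) (interchange a b (a ^ k) (b ^ k))
  where
  interchange : ∀ a b c d → a * b * (c * d) ≡ a * c * (b * d)
  interchange = solve-∀

-- With M = 2Δ + 3, maximality gives n² < p(2ρ)^M. Multiplying h^M by this and inserting hρ ≤ Kn²
-- bounds h^M n² by p(2K)^M n^(2M); cancelling n² leaves the exponent 2M - 2 = 4Δ + 4.
balance : ∀ n Δ ρ h K p → 1 ≤ n → 1 ≤ ρ → n * n < p * suc ρ ^ (2 * Δ + 3) → h * ρ ≤ K * (n * n) →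
  h ^ (2 * Δ + 3) ≤ (2 * K) ^ (2 * Δ + 3) * n ^ (4 * Δ + 4) * p
balance n Δ ρ h K p 1≤n 1≤ρ nn< hρ≤ = *-cancelʳ-≤ _ _ (n * n) (begin
  h ^ M * (n * n)                           ≤⟨ *-monoʳ-≤ (h ^ M) (<⇒≤ nn<) ⟩
  h ^ M * (p * suc ρ ^ M)                   ≤⟨ *-monoʳ-≤ (h ^ M) (*-monoʳ-≤ p (^-monoˡ-≤ M 1+ρ≤2ρ)) ⟩
  h ^ M * (p * (2 * ρ) ^ M)                 ≡⟨ x∙yz≈y∙xz (h ^ M) p ((2 * ρ) ^ M) ⟩
  p * (h ^ M * (2 * ρ) ^ M)                 ≡⟨ cong (p *_) (^-distribʳ-* h (2 * ρ) M) ⟨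
  p * (h * (2 * ρ)) ^ M                     ≡⟨ cong (λ x → p * x ^ M) (x∙yz≈y∙xz h 2 ρ) ⟩
  p * (2 * (h * ρ)) ^ M                     ≤⟨ *-monoʳ-≤ p (^-monoˡ-≤ M (*-monoʳ-≤ 2 hρ≤)) ⟩
  p * (2 * (K * (n * n))) ^ M               ≡⟨ cong (λ x → p * x ^ M) (*-assoc 2 K (n * n)) ⟨
  p * (2 * K * (n * n)) ^ M                 ≡⟨ cong (p *_) (^-distribʳ-* (2 * K) (n * n) M) ⟩
  p * ((2 * K) ^ M * (n * n) ^ M)           ≡⟨ cong (λ x → p * ((2 * K) ^ M * x)) split ⟩
  p * ((2 * K) ^ M * (n ^ E * (n * n)))     ≡⟨ rearrange p ((2 * K) ^ M) (n ^ E) (n * n) ⟩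
  (2 * K) ^ M * n ^ E * p * (n * n)         ∎)
  where
  open ≤-Reasoning
  open CommutativeSemigroup *-commutativeSemigroup using (x∙yz≈y∙xz)
  M E : ℕ
  M = 2 * Δ + 3
  E = 4 * Δ + 4
  instance nn≢0 = >-nonZero (*-mono-≤ 1≤n 1≤n)
  1+ρ≤2ρ : suc ρ ≤ 2 * ρ
  1+ρ≤2ρ = subst (suc ρ ≤_) (cong (ρ +_) (sym (+-identityʳ ρ))) (+-monoˡ-≤ ρ 1≤ρ)
  M+M≡E+2 : ∀ δ → (2 * δ + 3) + (2 * δ + 3) ≡ (4 * δ + 4) + 2
  M+M≡E+2 = solve-∀
  split : (n * n) ^ M ≡ n ^ E * (n * n)
  split = begin-equality
    (n * n) ^ M       ≡⟨ ^-distribʳ-* n n M ⟩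
    n ^ M * n ^ M     ≡⟨ ^-distribˡ-+-* n M M ⟨
    n ^ (M + M)       ≡⟨ cong (n ^_) (M+M≡E+2 Δ) ⟩
    n ^ (E + 2)       ≡⟨ ^-distribˡ-+-* n E 2 ⟩
    n ^ E * (n * (n * 1)) ≡⟨ cong (λ x → n ^ E * (n * x)) (*-identityʳ n) ⟩
    n ^ E * (n * n)   ∎
  rearrange : ∀ p k e q → p * (k * (e * q)) ≡ k * e * p * q
  rearrange = solve-∀

-- The pair term is at most 2n² ≤ 2Δkn² by the choice of `ρ`; the sourcewise terms give 96Δkn² after
-- `suc Δ` is bounded by 2Δ. Together this is 98.
budget : ∀ n Δ k ρ p → 1 ≤ Δ → 1 ≤ k → p * ρ ^ (2 * Δ + 3) ≤ n * n →
  2 * (p * (ρ * (ρ ^ suc Δ * ρ ^ suc Δ))) + 2 * (n * (suc Δ * (2 * (2 * n * (k * 6))))) ≤ 98 * Δ * k * (n * n)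
budget n Δ k ρ p 1≤Δ 1≤k ρ-small = begin
  2 * (p * (ρ * (ρ ^ suc Δ * ρ ^ suc Δ))) + T (suc Δ)  ≡⟨ cong (λ x → 2 * (p * (ρ * x)) + T (suc Δ)) (^-distribˡ-+-* ρ (suc Δ) (suc Δ)) ⟨
  2 * (p * ρ ^ suc (suc Δ + suc Δ)) + T (suc Δ)        ≡⟨ cong (λ x → 2 * (p * ρ ^ x) + T (suc Δ)) (exponent Δ) ⟩
  2 * (p * ρ ^ (2 * Δ + 3)) + T (suc Δ)                ≤⟨ +-mono-≤ (*-monoʳ-≤ 2 (≤-trans ρ-small nn≤))
                                                           (*-monoʳ-≤ 2 (*-monoʳ-≤ n (*-monoˡ-≤ (2 * (2 * n * (k * 6))) (+-monoˡ-≤ Δ 1≤Δ)))) ⟩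
  2 * (Δ * k * (n * n)) + T (Δ + Δ)                    ≡⟨ collect n Δ k ⟩
  98 * Δ * k * (n * n)                                 ∎
  where
  open ≤-Reasoning
  T : ℕ → ℕ
  T x = 2 * (n * (x * (2 * (2 * n * (k * 6)))))
  nn≤ : n * n ≤ Δ * k * (n * n)
  nn≤ = m≤n*m (n * n) (Δ * k) {{>-nonZero (*-mono-≤ 1≤Δ 1≤k)}}
  exponent : ∀ x → suc (suc x + suc x) ≡ 2 * x + 3
  exponent = solve-∀
  collect : ∀ n x y → 2 * (x * y * (n * n)) + 2 * (n * ((x + x) * (2 * (2 * n * (y * 6))))) ≡ 98 * x * y * (n * n)
  collect = solve-∀

-- The preserver and its size

simple⇒empty : ∀ {n} d (G : List (Edge n)) → n ≤ 1 → Simple d G → G ≡ []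
simple⇒empty d [] _ _ = refl
simple⇒empty {suc zero} d ((Fin.zero , Fin.zero , c) ∷ G) _ (loopless ∷ _ , _) = contradiction refl loopless
simple⇒empty {suc (suc n)} d (_ ∷ _) (s≤s ()) _

sparse-preserver : ∀ {n Δ k} → 1 ≤ k → suc (n * n) * (n * n) < 2 ^ (k * 6) → 1 ≤ Δ → (d : Bool) (G : List (Edge n)) → Simple d G →
  (∀ c → length (colorClass c G) ≤ Δ) → (P : List (Fin n × Fin n)) →
  ∀ ρ → 1 ≤ ρ → length P * ρ ^ (2 * Δ + 3) ≤ n * n →
  ∃[ H ] ((H ⊆ G) × OneCFTPreserver d G H P × (length H * ρ ≤ 98 * Δ * k * (n * n)))
sparse-preserver {n} {Δ} {k} 1≤k small 1≤Δ d G simple class≤Δ P ρ 1≤ρ ρ-small = H , filter-⊆ (_∈? F) G , preserves , Hρ≤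
  where
  open Distance (incidence d)
  open DecMembership (≡-dec Fin._≟_ (≡-dec Fin._≟_ _≟_)) using (_∈?_)
  few-edges : length G ≤ n * n
  few-edges = subst (_≤ n * n) (length-map _ G) (unique-pairs⇒length≤ (simple⇒unique-pairs d simple))
  recovery = pairwise (incidence d) G Δ ρ (k * 6) 1≤ρ class≤Δ (≤-<-trans (*-monoˡ-≤ (n * n) (s≤s few-edges)) small) P
  F H : List (Edge n)
  F = proj₁ recovery
  -- Filtering `G`, instead of taking `F`, makes `H` a sublist of `G` without repetitions, hence no
  -- longer than `F`.
  H = filter (_∈? F) G
  H≤F : length H ≤ length F
  H≤F = unique⇒length≤ (Unique.filter⁺ (_∈? F) (Unique.map⁻ (simple⇒unique-pairs d simple))) (proj₂ ∘ ∈-filter⁻ (_∈? F) {xs = G})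
  Hρ≤ : length H * ρ ≤ 98 * Δ * k * (n * n)
  Hρ≤ = ≤-trans (*-monoˡ-≤ ρ H≤F) (≤-trans (proj₁ (proj₂ recovery)) (budget n Δ k ρ (length P) 1≤Δ 1≤k ρ-small))
  deleteColor-mono : ∀ {c e} → e ∈ deleteColor c H → e ∈ deleteColor c G
  deleteColor-mono e∈ = let e∈H , e≢c = ∈-deleteColor⁻ H e∈ in ∈-deleteColor⁺ (proj₁ (∈-filter⁻ (_∈? F) {xs = G} e∈H)) e≢c
  preserves : OneCFTPreserver d G H P
  preserves c st∈P l = mk⇔
    (λ (j , j≤l , w) → let m , m≤j , dist = path⇒dist (walk⇒path d w) in
      m , ≤-trans m≤j j≤l , path⇒walk d (proj₂ (proj₂ recovery) (λ e∈F e∈G → ∈-filter⁺ (_∈? F) e∈G e∈F) st∈P dist))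
    (λ (j , j≤l , w) → j , j≤l , path⇒walk d (path-mono deleteColor-mono (walk⇒path d w)))

-- The bound is raised to the power 2Δ + 3 to clear the roots; n then carries (2 - 2/(2Δ+3))(2Δ+3) =
-- 4Δ + 4. As `C` is chosen first, it is absolute.
theorem1p3 : ∃[ C ] (∀ (n Δ : ℕ) → 1 ≤ Δ → (d : Bool) (G : List (Edge n)) → Simple d G →
    (∀ c → length (colorClass c G) ≤ Δ) →
    (P : List (Fin n × Fin n)) → Unique P →
    ∃[ H ] ((H ⊆ G) × OneCFTPreserver d G H P ×
    (length H ^ (2 * Δ + 3)
    ≤ (C * Δ * ⌈log₂ n ⌉) ^ (2 * Δ + 3) * n ^ (4 * Δ + 4) * length P)))
-- Twice the 98 of `budget`; the factor 2 comes from `suc ρ ≤ 2 * ρ` in `balance`.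
theorem1p3 = 196 , λ n Δ 1≤Δ d G simple class≤Δ P uniqueP → preserver n Δ 1≤Δ d G simple class≤Δ P uniqueP (2 ≤? n)
  where
  bound : ℕ → ℕ → ℕ → ℕ
  bound n Δ p = (196 * Δ * ⌈log₂ n ⌉) ^ (2 * Δ + 3) * n ^ (4 * Δ + 4) * p
  0≤bound : ∀ n Δ p → 0 ^ (2 * Δ + 3) ≤ bound n Δ p
  0≤bound n Δ p = subst (_≤ bound n Δ p) (cong (0 ^_) (+-comm 3 (2 * Δ))) z≤n
  grows : ∀ n p M → 1 ≤ p → 1 ≤ M → n * n < p * suc (n * n) ^ M
  grows n (suc p) M _ 1≤M = begin-strict
    n * n                     <⟨ n<1+n (n * n) ⟩
    suc (n * n)               ≡⟨ ^-identityʳ _ ⟨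
    suc (n * n) ^ 1           ≤⟨ ^-monoʳ-≤ (suc (n * n)) 1≤M ⟩
    suc (n * n) ^ M           ≤⟨ m≤m+n _ _ ⟩
    suc p * suc (n * n) ^ M   ∎
    where open ≤-Reasoning
  double : ∀ x y → 2 * (98 * x * y) ≡ 196 * x * y
  double = solve-∀
  preserver : ∀ n Δ → 1 ≤ Δ → (d : Bool) (G : List (Edge n)) → Simple d G →
    (∀ c → length (colorClass c G) ≤ Δ) → (P : List (Fin n × Fin n)) → Unique P → Dec (2 ≤ n) →
    ∃[ H ] ((H ⊆ G) × OneCFTPreserver d G H P × (length H ^ (2 * Δ + 3) ≤ bound n Δ (length P)))
  -- Without pairs every `ρ` satisfies the constraint, so a maximal one does not exist.
  preserver n Δ _ d G _ _ [] _ _ = [] , minimum G , (λ c ()) , 0≤bound n Δ 0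
  -- For n ≤ 1 the logarithm and with it the bound vanish, but `G` has no edges, as they would be
  -- loops.
  preserver n Δ _ d G simple _ P@(_ ∷ _) _ (no n<2) = [] , minimum G ,
    (λ c _ k → subst (λ E → DistAtMost d (deleteColor c E) _ _ k ⇔ _) (sym (simple⇒empty d G (≤-pred (≰⇒> n<2)) simple)) (mk⇔ (λ x → x) (λ x → x))) ,
    0≤bound n Δ (length P)
  preserver n Δ 1≤Δ d G simple class≤Δ P@(_ ∷ _) uniqueP (yes 2≤n) =
    let M = 2 * Δ + 3
        -- The value 1 is admissible because |P| ≤ n² for distinct pairs, and n² + 1 is too large by
        -- `grows`.
        ρ , 1≤ρ , ρ-small , ρ-large = threshold (λ ρ → length P * ρ ^ M) (n * n) (n * n)
          (subst (_≤ n * n) (sym (trans (cong (length P *_) (^-zeroˡ M)) (*-identityʳ _))) (unique-pairs⇒length≤ uniqueP))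
          (grows n (length P) M (s≤s z≤n) (≤-trans (s≤s z≤n) (m≤n+m 3 (2 * Δ))))
        H , H⊆G , preserves , Hρ≤ = sparse-preserver {k = ⌈log₂ n ⌉} (1≤⌈log₂n⌉ {n} 2≤n) (few-deletions n 2≤n) 1≤Δ d G simple class≤Δ P ρ 1≤ρ ρ-small
    in H , H⊆G , preserves ,
       subst (λ x → length H ^ M ≤ x ^ M * n ^ (4 * Δ + 4) * length P) (double Δ ⌈log₂ n ⌉)
         (balance n Δ ρ (length H) (98 * Δ * ⌈log₂ n ⌉) (length P) (<⇒≤ 2≤n) 1≤ρ ρ-large Hρ≤)
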